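{- For every field $\mathbb{F}$ and all $m>n$, every tree-like $\mathrm{Res}_{sw}(\mathrm{lin}_{\mathbb{F}})$ refutation of $\neg\mathrm{PHP}^m_n$ has size $2^{\Omega(\frac{n-1}{2})}$.
   Context: $\neg\mathrm{PHP}^m_n$ is the CNF over variables $x_{i,j}$ ($i\in[m]$, $j\in[n]$) consisting of the clauses $\bigvee_{j\in[n]}x_{i,j}$ for each $i\in[m]$ and $\neg x_{i,j}\vee\neg x_{i',j}$ for all $i\ne i'\in[m]$, $j\in[n]$; a CNF is viewed as a set of linear clauses by writing a literal $x$ as $x=1$ and $\neg x$ as $x=0$. A linear clause over $\mathbb{F}$ is a disjunction of linear equations $f=0$, $f=\sum_i a_ix_i+b$ (duplicates identified); variables range over $\{0,1\}$ and $\models$ denotes semantic implication with respect to 0-1 assignments. The system $\mathrm{Res}_{sw}(\mathrm{lin}_{\mathbb{F}})$ has the single axiom $0=0$ and the rules: resolution (from $C\vee f=0$ and $D\vee g=0$ derive $C\vee D\vee(\alpha f+\beta g=0)$, $\alpha,\beta\in\mathbb{F}$) and semantic weakening (from $C$ derive any linear clause $D$ with $C\models D$). A refutation of a set $\phi$ of linear clauses is a sequence of linear clauses ending in the empty clause, each in $\phi$, the axiom, or obtained from earlier ones by a rule; tree-like means every occurrence of a clause is used at most once as a premise. Size is the total number of variable occurrences plus the total size of coefficients. -}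

module Defs where

open import Level using (Level; _⊔_; suc)
open import Algebra.Bundles using (CommutativeRing)
open import Data.Nat as ℕ using (ℕ; zero) renaming (_+_ to _+ℕ_)
open import Data.Bool using (Bool; true; false)
open import Data.Fin using (Fin)
import Data.Fin as Fin
open import Data.List using (List; []; _∷_; map; allFin; foldr)
open import Data.List.Membership.Propositional using (_∈_)
open import Data.List.Relation.Unary.Any using (Any)
open import Data.Product using (Σ; _×_; _,_; ∃-syntax)
open import Relation.Nullary using (¬_; yes; no)
open import Relation.Nullary.Decidable using (_×-dec_)
open import Relation.Binary.PropositionalEquality using (_≡_)
open import Function.Bundles using (_⇔_)

record Field (c ℓ : Level) : Set (suc (c ⊔ ℓ)) where
  field
    commutativeRing : CommutativeRing c ℓ
  open CommutativeRing commutativeRing public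
  field
    0≉1     : ¬ (0# ≈ 1#)
    inverse : ∀ x → ¬ (x ≈ 0#) → ∃[ y ] (x * y ≈ 1#)

module LinearClauses {c ℓ} (F : Field c ℓ) (m n : ℕ) where
  open Field F

  Var : Set
  Var = Fin m × Fin n

  -- a linear form  Σ_k a_k x_{v_k} + b, written as a list of terms (a_k , v_k)
  -- (each term is one variable occurrence with its coefficient) and a constant b
  record LinForm : Set c where
    constructor lin
    field
      terms : List (Carrier × Var)
      const : Carrier
  open LinForm public

  -- a linear clause: the disjunction of the equations f = 0 for f in the list
  -- (list membership gives the set of equations, duplicates identified)
  Clause : Set c
  Clause = List LinForm

  Σ[_] : List Carrier → Carrier
  Σ[_] = foldr _+_ 0#

  coeff : LinForm → Var → Carrier
  coeff f (i , j) = Σ[ map pick (terms f) ]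
    where
    pick : Carrier × Var → Carrier
    pick (a , (i' , j')) with (i Fin.≟ i') ×-dec (j Fin.≟ j')
    ... | yes _ = a
    ... | no  _ = 0#

  IsLinComb : Carrier → LinForm → Carrier → LinForm → LinForm → Set ℓ
  IsLinComb α f β g h =
    (∀ v → coeff h v ≈ (α * coeff f v) + (β * coeff g v))
    × (const h ≈ (α * const f) + (β * const g))

  Assignment : Set
  Assignment = Var → Bool

  bit : Bool → Carrier
  bit true  = 1#
  bit false = 0#

  eval : Assignment → LinForm → Carrier
  eval ρ f = Σ[ map (λ { (a , v) → a * bit (ρ v) }) (terms f) ] + const f

  Sat : Assignment → Clause → Set (c ⊔ ℓ)
  Sat ρ C = Any (λ f → eval ρ f ≈ 0#) C

  _⊨_ : Clause → Clause → Set (c ⊔ ℓ)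
  C ⊨ D = ∀ (ρ : Assignment) → Sat ρ C → Sat ρ D

  _≋_ : Clause → Clause → Set c
  C ≋ D = ∀ e → (e ∈ C) ⇔ (e ∈ D)

  -- the linear forms x_{i,j} - 1  (literal x_{i,j}, i.e. x_{i,j} = 1)
  -- and x_{i,j}  (literal ¬x_{i,j}, i.e. x_{i,j} = 0)
  posLit negLit : Var → LinForm
  posLit v = lin ((1# , v) ∷ []) (- 1#)
  negLit v = lin ((1# , v) ∷ []) 0#

  data NegPHP : Clause → Set where
    pigeon : (i : Fin m) → NegPHP (map (λ j → posLit (i , j)) (allFin n))
    hole   : (i i' : Fin m) → ¬ (i ≡ i') → (j : Fin n) →
             NegPHP (negLit (i , j) ∷ negLit (i' , j) ∷ [])

  zeroEq : LinForm
  zeroEq = lin [] 0#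

  -- tree-like Res_sw(lin_F) derivations from a set φ of linear clauses
  -- (tree-like: each clause occurrence is used at most once as a premise)
  data Deriv (φ : Clause → Set) : Clause → Set (suc (c ⊔ ℓ)) where
    hyp     : ∀ {C} → φ C → Deriv φ C
    axiom   : Deriv φ (zeroEq ∷ [])
    resolve : ∀ {P Q E} (C D : Clause) (f g h : LinForm) (α β : Carrier) →
              Deriv φ P → Deriv φ Q →
              P ≋ (f ∷ C) → Q ≋ (g ∷ D) →
              IsLinComb α f β g h →
              E ≋ (h ∷ (C Data.List.++ D)) →
              Deriv φ E
    weaken  : ∀ {C D} → Deriv φ C → C ⊨ D → Deriv φ D

  Refutation : (Clause → Set) → Set (suc (c ⊔ ℓ))
  Refutation φ = Deriv φ []

  -- size, given a size measure ∥_∥ for field elements (coefficients):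
  -- number of variable occurrences plus total size of coefficients
  module Size (∥_∥ : Carrier → ℕ) where
    sumℕ : List ℕ → ℕ
    sumℕ = foldr _+ℕ_ 0

    formSize : LinForm → ℕ
    formSize f = sumℕ (map (λ { (a , _) → 1 +ℕ ∥ a ∥ }) (terms f)) +ℕ ∥ const f ∥

    clauseSize : Clause → ℕ
    clauseSize C = sumℕ (map formSize C)

    size : ∀ {φ C} → Deriv φ C → ℕ
    size {C = C} (hyp _)     = clauseSize C
    size {C = C} axiom       = clauseSize C
    size {C = E} (resolve _ _ _ _ _ _ _ p q _ _ _ _) = clauseSize E +ℕ size p +ℕ size q
    size {C = D} (weaken p _) = clauseSize D +ℕ size p

{-# OPTIONS --safe #-}

-- Walk up the tree from the root, recording a list Ψ of linear forms such that
-- every assignment with at most one pigeon per hole on which no form of Ψ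
-- vanishes falsifies the current clause, and such an assignment exists.  At a
-- resolution step on f and g, if f vanishes on all these assignments then g can
-- be taken to be nonzero for free (and vice versa); otherwise both premises are
-- reached, each at the cost of one new form.  Leaves can only be pigeon clauses,
-- and there Ψ has at least n forms: for σ avoiding Ψ, let the cube {0,1}^n act by
-- moving pigeon i into the selected holes.  The product of Ψ is nonzero at the
-- origin of the cube only, whereas its alternating sum over the cube vanishes if
-- it has fewer than n factors.  Hence there are at least 2^n leaves.
module Submission where

open import Defs
open import Level using (Level; _⊔_)
open import Data.Nat using (ℕ; _≤_; _<_; _^_; _∸_; _/_)

open import Algebra.Bundles using (CommutativeRing)
import Algebra.Properties.CommutativeSemigroup as CommutativeSemigroupProperties
import Algebra.Properties.Ring as RingProperties
import Algebra.Properties.Semiring.Sum as SemiringSum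
open import Data.Bool using (Bool; true; false; if_then_else_)
open import Data.Empty using (⊥-elim)
open import Data.Fin using (Fin; zero; suc)
import Data.Fin as Fin
import Data.Fin.Properties as Fin
open import Data.List using (List; []; _∷_; _++_; map; foldr; length; allFin)
import Data.List.Properties as List
open import Data.List.Membership.Propositional using (_∈_; lose)
open import Data.List.Membership.Propositional.Properties using (∈-allFin; ∈-map⁺)
open import Data.List.Relation.Binary.Subset.Propositional.Properties using (Any-resp-⊆)
open import Data.List.Relation.Unary.All using (All; []; _∷_)
import Data.List.Relation.Unary.All.Properties as All
open import Data.List.Relation.Unary.Any using (here; there)
import Data.List.Relation.Unary.Any.Properties as Any
open import Data.Maybe using (Maybe; just; nothing)
import Data.Maybe.Properties as Maybe
open import Data.Nat using (zero; suc; s≤s; _≤?_; _<?_)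
import Data.Nat as ℕ
import Data.Nat.Properties as ℕ
import Data.Nat.DivMod as ℕ
open import Data.Product using (Σ; _×_; _,_; proj₁; proj₂; ∃-syntax)
open import Data.Unit.Polymorphic using (⊤; tt)
open import Data.Vec using (Vec; []; _∷_; lookup; replicate)
import Data.Vec.Properties as Vec
open import Function using (_∘_; const)
open import Function.Bundles using (Equivalence)
open import Relation.Binary.PropositionalEquality as ≡ using (_≡_)
import Relation.Binary.Reasoning.Setoid as SetoidReasoning
open import Relation.Nullary using (¬_; yes; no; does; contradiction)
open import Relation.Nullary.Decidable using (_×-dec_; decidable-stable; dec-true; ¬¬-excluded-middle)

-- The cube is finite, so double negation passes through the quantifier one coordinate at a time.
-- This makes up for equality in the field not being decidable.
¬¬-cube : ∀ {p} k {P : Vec Bool k → Set p} → (∀ x → ¬ ¬ P x) → ¬ ¬ (∀ x → P x)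
¬¬-cube zero    nn ¬P = nn [] λ p → ¬P λ { [] → p }
¬¬-cube (suc k) nn ¬P =
  ¬¬-cube k (nn ∘ (false ∷_)) λ P₀ →
  ¬¬-cube k (nn ∘ (true ∷_)) λ P₁ →
  ¬P λ { (false ∷ x) → P₀ x ; (true ∷ x) → P₁ x }

-- Affine functions on the Boolean cube

module Cube {c ℓ} (R : CommutativeRing c ℓ) where
  open CommutativeRing R hiding (zero)
  open RingProperties ring using (-0#≈0#; -‿distribˡ-*; -‿+-comm; xyx⁻¹≈y; x[y-z]≈xy-xz)
  open CommutativeSemigroupProperties *-commutativeSemigroup using (x∙yz≈yx∙z; x∙yz≈y∙xz)
  open CommutativeSemigroupProperties +-commutativeSemigroup using () renaming (interchange to +-interchange)
  open SetoidReasoning setoid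

  -- a degree-one function restricts to degree-one functions on both facets,
  -- which differ by a constant
  IsAffine : ∀ k → (Vec Bool k → Carrier) → Set (c ⊔ ℓ)
  IsAffine zero    f = ⊤
  IsAffine (suc k) f =
    (∃[ a ] ∀ x → f (true ∷ x) ≈ f (false ∷ x) + a) ×
    IsAffine k (f ∘ (false ∷_)) × IsAffine k (f ∘ (true ∷_))

  affine-resp : ∀ k {f g} → (∀ x → f x ≈ g x) → IsAffine k f → IsAffine k g
  affine-resp zero    eq af = tt
  affine-resp (suc k) eq ((a , d) , af₀ , af₁) =
    (a , λ x → trans (sym (eq _)) (trans (d x) (+-congʳ (eq _)))) ,
    affine-resp k (λ _ → eq _) af₀ , affine-resp k (λ _ → eq _) af₁

  affine-const : ∀ k a → IsAffine k (const a)
  affine-const zero    a = tt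
  affine-const (suc k) a =
    (0# , λ _ → sym (+-identityʳ a)) , affine-const k a , affine-const k a

  affine-+ : ∀ k {f g} → IsAffine k f → IsAffine k g → IsAffine k (λ x → f x + g x)
  affine-+ zero af ag = tt
  affine-+ (suc k) ((a , d) , af₀ , af₁) ((b , e) , ag₀ , ag₁) =
    (a + b , λ x → trans (+-cong (d x) (e x)) (+-interchange _ a _ b)) ,
    affine-+ k af₀ ag₀ , affine-+ k af₁ ag₁

  affine-* : ∀ k r {f} → IsAffine k f → IsAffine k (λ x → r * f x)
  affine-* zero    r af = tt
  affine-* (suc k) r ((a , d) , af₀ , af₁) =
    (r * a , λ x → trans (*-congˡ (d x)) (distribˡ r _ a)) ,
    affine-* k r af₀ , affine-* k r af₁

  -- The slope is `h p - h q` in direction `j` and zero in every other. Applied below to the content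
  -- of hole `j` while a pigeon is being moved.
  affine-select : ∀ {a} {A : Set a} k (h : A → Carrier) (p q : A) (j : Fin k) →
    IsAffine k (λ x → h (if lookup x j then p else q))
  affine-select (suc k) h p q zero =
    (h p - h q , λ _ → trans (sym (xyx⁻¹≈y (h q) (h p))) (+-assoc _ _ _)) ,
    affine-const k (h q) , affine-const k (h p)
  affine-select (suc k) h p q (suc j) =
    (0# , λ _ → sym (+-identityʳ _)) , affine-select k h p q j , affine-select k h p q j

  -- Alternating sums over the cube

  -- The sum of `P x` with sign given by the parity of the number of `true` entries of `x`, written
  -- as an iterated difference.
  alt : ∀ k → (Vec Bool k → Carrier) → Carrier
  alt zero    P = P []
  alt (suc k) P = alt k (λ x → P (false ∷ x) - P (true ∷ x))

  alt-cong : ∀ k {P Q} → (∀ x → P x ≈ Q x) → alt k P ≈ alt k Q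
  alt-cong zero    eq = eq []
  alt-cong (suc k) eq = alt-cong k λ x → +-cong (eq _) (-‿cong (eq _))

  alt-+ : ∀ k P Q → alt k (λ x → P x + Q x) ≈ alt k P + alt k Q
  alt-+ zero    P Q = refl
  alt-+ (suc k) P Q = trans
    (alt-cong k λ x → trans (+-congˡ (sym (-‿+-comm _ _))) (+-interchange _ _ _ _))
    (alt-+ k _ _)

  alt-* : ∀ k r P → alt k (λ x → r * P x) ≈ r * alt k P
  alt-* zero    r P = refl
  alt-* (suc k) r P = trans
    (alt-cong k λ x → sym (x[y-z]≈xy-xz r _ _))
    (alt-* k r _)

  alt-zero : ∀ k {P} → (∀ x → P x ≈ 0#) → alt k P ≈ 0#
  alt-zero zero    eq = eq []
  alt-zero (suc k) eq = alt-zero k λ x →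
    trans (+-cong (eq _) (trans (-‿cong (eq _)) -0#≈0#)) (+-identityˡ 0#)

  -- Each differencing subtracts a value at a point with a `true` coordinate, which is zero.
  alt-supported-at-origin : ∀ k {P} →
    (∀ x → (∃[ j ] lookup x j ≡ true) → P x ≈ 0#) → alt k P ≈ P (replicate k false)
  alt-supported-at-origin zero    eq = refl
  alt-supported-at-origin (suc k) {P} eq = trans
    (alt-supported-at-origin k λ { x (j , xⱼ) → trans
       (minus-zero (eq (true ∷ x) (zero , ≡.refl))) (eq (false ∷ x) (suc j , xⱼ)) })
    (minus-zero (eq _ (zero , ≡.refl)))
    where
    minus-zero : ∀ {u v} → v ≈ 0# → u - v ≈ u
    minus-zero {u} v≈0 =
      trans (+-congˡ (trans (-‿cong v≈0) -0#≈0#)) (+-identityʳ u)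

  -- Products of affine functions

  Π : ∀ {k} → List (Vec Bool k → Carrier) → Vec Bool k → Carrier
  Π fs x = foldr (λ f r → f x * r) 1# fs

  Π-++ : ∀ {k} (fs gs : List (Vec Bool k → Carrier)) x → Π (fs ++ gs) x ≈ Π fs x * Π gs x
  Π-++ []       gs x = sym (*-identityˡ _)
  Π-++ (f ∷ fs) gs x = trans (*-congˡ (Π-++ fs gs x)) (sym (*-assoc _ _ _))

  Π-map : ∀ {j k} (h : Vec Bool j → Vec Bool k) fs x → Π (map (_∘ h) fs) x ≡ Π fs (h x)
  Π-map h []       x = ≡.refl
  Π-map h (f ∷ fs) x = ≡.cong (f (h x) *_) (Π-map h fs x)

  -- Fewer than `k` affine factors give degree below `k`, and each of the `k` differencings in `alt`
  -- lowers the degree by one.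
  alt-Π : ∀ k fs → All (IsAffine k) fs → length fs < k → alt k (Π fs) ≈ 0#

  -- telescoping: the difference of Π fs over two opposite facets is a sum of
  -- products with one factor fewer
  alt-Π-diff : ∀ k gs (fs : List (Vec Bool (suc k) → Carrier)) →
    All (IsAffine k) gs → All (IsAffine (suc k)) fs → length gs ℕ.+ length fs ≤ k →
    alt k (λ x → Π gs x * (Π fs (false ∷ x) - Π fs (true ∷ x))) ≈ 0#

  alt-Π (suc k) fs afs (s≤s fs≤k) = trans
    (alt-cong k λ _ → sym (*-identityˡ _))
    (alt-Π-diff k [] fs [] afs fs≤k)

  alt-Π-diff k gs []       ags afs le =
    alt-zero k λ x → trans (*-congˡ (-‿inverseʳ 1#)) (zeroʳ _)
  alt-Π-diff k gs (f ∷ fs) ags (((a , d) , af₀ , af₁) ∷ afs) le = begin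
    alt k (λ x → G x * (f₀ x * X x - f₁ x * Y x))
      -- Substitute `f₁ = f₀ + a`: the `f₀` part joins the accumulated factors `G`, while the
      -- constant `a` leaves a product without any factor from `f`.
      ≈⟨ alt-cong k (λ x → trans (*-congˡ (+-congˡ (-‿cong (*-congʳ (d x)))))
                                 (split (G x) (f₀ x) (X x) (Y x))) ⟩
    alt k (λ x → Π (f₀ ∷ gs) x * (X x - Y x) + (- a) * (G x * Y x))
      ≈⟨ alt-+ k _ _ ⟩
    alt k (λ x → Π (f₀ ∷ gs) x * (X x - Y x)) + alt k (λ x → (- a) * (G x * Y x))
      ≈⟨ +-cong (alt-Π-diff k (f₀ ∷ gs) fs (af₀ ∷ ags) afs le′) (alt-* k (- a) _) ⟩
    0# + (- a) * alt k (λ x → G x * Y x)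
      ≈⟨ +-identityˡ _ ⟩
    (- a) * alt k (λ x → G x * Y x)
      ≈⟨ *-congˡ (alt-cong k λ x → trans (*-congˡ (reflexive (≡.sym (Π-map (true ∷_) fs x))))
                                         (sym (Π-++ gs _ x))) ⟩
    (- a) * alt k (Π (gs ++ map (_∘ (true ∷_)) fs))
      -- With `f` gone, fewer than `k` factors remain, so the claim in dimension `k` applies.
      ≈⟨ *-congˡ (alt-Π k _ (All.++⁺ ags (facet afs)) fewer) ⟩
    (- a) * 0#
      ≈⟨ zeroʳ _ ⟩
    0# ∎
    where
    G X Y f₀ f₁ : Vec Bool k → Carrier
    G    = Π gs
    X x  = Π fs (false ∷ x)
    Y x  = Π fs (true ∷ x)
    f₀ x = f (false ∷ x)
    f₁ x = f (true ∷ x)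

    le′ : suc (length gs ℕ.+ length fs) ≤ k
    le′ = ≡.subst (_≤ k) (ℕ.+-suc (length gs) (length fs)) le

    split : ∀ g u x y → g * (u * x - (u + a) * y) ≈ (u * g) * (x - y) + (- a) * (g * y)
    split g u x y = begin
      g * (u * x - (u + a) * y)
        ≈⟨ *-congˡ (+-congˡ (trans (-‿cong (distribʳ y u a)) (sym (-‿+-comm _ _)))) ⟩
      g * (u * x + (- (u * y) + - (a * y)))
        ≈⟨ *-congˡ (sym (+-assoc _ _ _)) ⟩
      g * ((u * x - u * y) + - (a * y))
        ≈⟨ *-congˡ (+-cong (sym (x[y-z]≈xy-xz u x y)) (-‿distribˡ-* a y)) ⟩
      g * (u * (x - y) + (- a) * y)
        ≈⟨ distribˡ g _ _ ⟩
      g * (u * (x - y)) + g * ((- a) * y)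
        ≈⟨ +-cong (x∙yz≈yx∙z g u (x - y)) (x∙yz≈y∙xz g (- a) y) ⟩
      (u * g) * (x - y) + (- a) * (g * y) ∎

    facet : ∀ {hs} → All (IsAffine (suc k)) hs → All (IsAffine k) (map (_∘ (true ∷_)) hs)
    facet []                   = []
    facet ((_ , _ , ah₁) ∷ ahs) = ah₁ ∷ facet ahs

    fewer : length (gs ++ map (_∘ (true ∷_)) fs) < k
    fewer = ≡.subst (_< k)
      (≡.sym (≡.trans (List.length-++ gs) (≡.cong (length gs ℕ.+_) (List.length-map _ fs)))) le′

module PHP {c ℓ} (F : Field c ℓ) (m n : ℕ) where
  open Field F hiding (zero)
  open LinearClauses F m n
  open Cube commutativeRing
  open CommutativeSemigroupProperties +-commutativeSemigroup using () renaming (interchange to +-interchange)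
  open SemiringSum semiring using (sum; sum-cong-≋; sum-replicate-zero; ∑-distrib-+; *-distribˡ-sum)
  open SetoidReasoning setoid

  *-nonzero : ∀ {x y} → ¬ (x ≈ 0#) → ¬ (y ≈ 0#) → ¬ (x * y ≈ 0#)
  *-nonzero {x} {y} x≉0 y≉0 xy≈0 with inverse x x≉0
  ... | x⁻¹ , xx⁻¹≈1 = y≉0 (begin
    y              ≈⟨ *-identityˡ y ⟨
    1# * y         ≈⟨ *-congʳ xx⁻¹≈1 ⟨
    (x * x⁻¹) * y  ≈⟨ *-congʳ (*-comm x x⁻¹) ⟩
    (x⁻¹ * x) * y  ≈⟨ *-assoc x⁻¹ x y ⟩
    x⁻¹ * (x * y)  ≈⟨ *-congˡ xy≈0 ⟩
    x⁻¹ * 0#       ≈⟨ zeroʳ x⁻¹ ⟩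
    0#             ∎)

  -- Evaluation in terms of coefficients

  sum-zero : ∀ {k} (g : Fin k → Carrier) → (∀ i → g i ≈ 0#) → sum g ≈ 0#
  sum-zero {k} g g≈0 = trans (sum-cong-≋ g≈0) (sum-replicate-zero k)

  sum-single : ∀ {k} (g : Fin k → Carrier) i → (∀ i′ → ¬ (i′ ≡ i) → g i′ ≈ 0#) → sum g ≈ g i
  sum-single g zero    g≈0 =
    trans (+-congˡ (sum-zero (g ∘ suc) λ i → g≈0 (suc i) λ ())) (+-identityʳ _)
  sum-single g (suc i) g≈0 = trans
    (+-cong (g≈0 zero λ ()) (sum-single (g ∘ suc) i λ i′ ne → g≈0 (suc i′) (ne ∘ Fin.suc-injective)))
    (+-identityˡ _)

  ⟨_,_⟩ : (Var → Carrier) → (Var → Carrier) → Carrier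
  ⟨ u , v ⟩ = sum λ i → sum λ j → u (i , j) * v (i , j)

  ⟨⟩-cong : ∀ {u u′} v → (∀ w → u w ≈ u′ w) → ⟨ u , v ⟩ ≈ ⟨ u′ , v ⟩
  ⟨⟩-cong v eq = sum-cong-≋ λ i → sum-cong-≋ λ j → *-congʳ (eq (i , j))

  ⟨⟩-+ : ∀ u u′ v → ⟨ (λ w → u w + u′ w) , v ⟩ ≈ ⟨ u , v ⟩ + ⟨ u′ , v ⟩
  ⟨⟩-+ u u′ v = trans
    (sum-cong-≋ λ i → trans
      (sum-cong-≋ λ j → distribʳ (v (i , j)) (u (i , j)) (u′ (i , j)))
      (∑-distrib-+ (row u i) (row u′ i)))
    (∑-distrib-+ (sum ∘ row u) (sum ∘ row u′))
    where
    row : (Var → Carrier) → Fin m → Fin n → Carrier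
    row t i j = t (i , j) * v (i , j)

  ⟨⟩-* : ∀ r u v → ⟨ (λ w → r * u w) , v ⟩ ≈ r * ⟨ u , v ⟩
  ⟨⟩-* r u v = trans
    (sum-cong-≋ λ i → trans
      (sum-cong-≋ λ j → *-assoc r (u (i , j)) (v (i , j)))
      (sym (*-distribˡ-sum r (row i))))
    (sym (*-distribˡ-sum r (sum ∘ row)))
    where
    row : Fin m → Fin n → Carrier
    row i j = u (i , j) * v (i , j)

  -- Repeats the test made by the local function `pick` of `coeff`, so that `coeff-∷` follows by the
  -- same case split.
  indicator : Carrier → Var → Var → Carrier
  indicator a (i′ , j′) (i , j) with (i Fin.≟ i′) ×-dec (j Fin.≟ j′)
  ... | yes _ = a
  ... | no _  = 0#

  indicator-refl : ∀ a w → indicator a w w ≡ a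
  indicator-refl a (i , j) with (i Fin.≟ i) ×-dec (j Fin.≟ j)
  ... | yes _ = ≡.refl
  ... | no ne = contradiction (≡.refl , ≡.refl) ne

  indicator-≢ : ∀ a w w′ → ¬ (w′ ≡ w) → indicator a w w′ ≡ 0#
  indicator-≢ a (i , j) (i′ , j′) ne with (i′ Fin.≟ i) ×-dec (j′ Fin.≟ j)
  ... | yes (≡.refl , ≡.refl) = contradiction ≡.refl ne
  ... | no _                  = ≡.refl

  ⟨⟩-indicator : ∀ a w v → ⟨ indicator a w , v ⟩ ≈ a * v w
  ⟨⟩-indicator a w@(i , j) v = begin
    ⟨ indicator a w , v ⟩
      ≈⟨ sum-single _ i (λ i′ ne → sum-zero (λ j′ → indicator a w (i′ , j′) * v (i′ , j′)) λ j′ → vanish (i′ , j′) (ne ∘ ≡.cong proj₁)) ⟩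
    (sum λ j′ → indicator a w (i , j′) * v (i , j′))
      ≈⟨ sum-single _ j (λ j′ ne → vanish (i , j′) (ne ∘ ≡.cong proj₂)) ⟩
    indicator a w w * v w
      ≈⟨ *-congʳ (reflexive (indicator-refl a w)) ⟩
    a * v w ∎
    where
    vanish : ∀ w′ → ¬ (w′ ≡ w) → indicator a w w′ * v w′ ≈ 0#
    vanish w′ ne = trans (*-congʳ (reflexive (indicator-≢ a w w′ ne))) (zeroˡ _)

  coeff-∷ : ∀ a w ts b v → coeff (lin ((a , w) ∷ ts) b) v ≡ indicator a w v + coeff (lin ts b) v
  coeff-∷ a (i′ , j′) ts b (i , j) with (i Fin.≟ i′) ×-dec (j Fin.≟ j′)
  ... | yes _ = ≡.refl
  ... | no _  = ≡.refl

  eval-∷ : ∀ ρ a w ts b → eval ρ (lin ((a , w) ∷ ts) b) ≈ a * bit (ρ w) + eval ρ (lin ts b)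
  eval-∷ ρ a w ts b = +-assoc _ _ _

  -- `IsLinComb` constrains coefficients and not term lists, so evaluating a resolvent requires this
  -- form.
  eval-coeff : ∀ ρ f → eval ρ f ≈ ⟨ coeff f , bit ∘ ρ ⟩ + LinForm.const f
  eval-coeff ρ (lin [] b) =
    +-congʳ (sym (sum-zero {m} _ λ i → sum-zero {n} _ λ j → zeroˡ (bit (ρ (i , j)))))
  eval-coeff ρ (lin ((a , w) ∷ ts) b) = begin
    eval ρ (lin ((a , w) ∷ ts) b)
      ≈⟨ eval-∷ ρ a w ts b ⟩
    a * bit (ρ w) + eval ρ (lin ts b)
      ≈⟨ +-cong (sym (⟨⟩-indicator a w v)) (eval-coeff ρ (lin ts b)) ⟩
    ⟨ indicator a w , v ⟩ + (⟨ coeff (lin ts b) , v ⟩ + b)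
      ≈⟨ +-assoc _ _ _ ⟨
    (⟨ indicator a w , v ⟩ + ⟨ coeff (lin ts b) , v ⟩) + b
      ≈⟨ +-congʳ (sym (⟨⟩-+ _ _ v)) ⟩
    ⟨ (λ w′ → indicator a w w′ + coeff (lin ts b) w′) , v ⟩ + b
      ≈⟨ +-congʳ (⟨⟩-cong v λ w′ → reflexive (≡.sym (coeff-∷ a w ts b w′))) ⟩
    ⟨ coeff (lin ((a , w) ∷ ts) b) , v ⟩ + b ∎
    where
    v : Var → Carrier
    v = bit ∘ ρ

  eval-linComb : ∀ {α β} f g h ρ → IsLinComb α f β g h →
    eval ρ h ≈ α * eval ρ f + β * eval ρ g
  eval-linComb {α} {β} f g h ρ (coeffs , consts) = begin
    eval ρ h
      ≈⟨ eval-coeff ρ h ⟩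
    ⟨ coeff h , v ⟩ + LinForm.const h
      ≈⟨ +-cong (trans (⟨⟩-cong v coeffs)
           (trans (⟨⟩-+ _ _ v) (+-cong (⟨⟩-* α _ v) (⟨⟩-* β _ v)))) consts ⟩
    (α * ⟨ coeff f , v ⟩ + β * ⟨ coeff g , v ⟩) + (α * LinForm.const f + β * LinForm.const g)
      ≈⟨ regroup ⟨ coeff f , v ⟩ ⟨ coeff g , v ⟩ (LinForm.const f) (LinForm.const g) ⟩
    α * (⟨ coeff f , v ⟩ + LinForm.const f) + β * (⟨ coeff g , v ⟩ + LinForm.const g)
      ≈⟨ +-cong (*-congˡ (eval-coeff ρ f)) (*-congˡ (eval-coeff ρ g)) ⟨
    α * eval ρ f + β * eval ρ g ∎
    where
    v : Var → Carrier
    v = bit ∘ ρ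

    regroup : ∀ p q r s → (α * p + β * q) + (α * r + β * s) ≈ α * (p + r) + β * (q + s)
    regroup p q r s = trans (+-interchange _ _ _ _)
      (+-cong (sym (distribˡ α p r)) (sym (distribˡ β q s)))

  eval-cong : ∀ {ρ ρ′} → (∀ v → ρ v ≡ ρ′ v) → ∀ f → eval ρ f ≈ eval ρ′ f
  eval-cong eq (lin []             b) = refl
  eval-cong {ρ} {ρ′} eq (lin ((a , w) ∷ ts) b) = trans (eval-∷ ρ a w ts b)
    (trans (+-cong (*-congˡ (reflexive (≡.cong bit (eq w)))) (eval-cong eq (lin ts b)))
           (sym (eval-∷ ρ′ a w ts b)))

  eval-affine : ∀ k (ρ : Vec Bool k → Assignment) → (∀ v → IsAffine k (λ x → bit (ρ x v))) →
    ∀ f → IsAffine k (λ x → eval (ρ x) f)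
  eval-affine k ρ aff (lin [] b) = affine-const k _
  eval-affine k ρ aff (lin ((a , w) ∷ ts) b) =
    affine-resp k (λ x → sym (eval-∷ (ρ x) a w ts b))
      (affine-+ k (affine-* k a (aff w)) (eval-affine k ρ aff (lin ts b)))

  eval-posLit : ∀ ρ v → ρ v ≡ true → eval ρ (posLit v) ≈ 0#
  eval-posLit ρ v ρv = begin
    (1# * bit (ρ v) + 0#) + - 1#  ≈⟨ +-congʳ (+-identityʳ _) ⟩
    1# * bit (ρ v) + - 1#         ≈⟨ +-congʳ (*-identityˡ _) ⟩
    bit (ρ v) + - 1#              ≈⟨ +-congʳ (reflexive (≡.cong bit ρv)) ⟩
    1# + - 1#                     ≈⟨ -‿inverseʳ 1# ⟩
    0#                            ∎

  eval-negLit : ∀ ρ v → ρ v ≡ false → eval ρ (negLit v) ≈ 0#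
  eval-negLit ρ v ρv = begin
    (1# * bit (ρ v) + 0#) + 0#  ≈⟨ +-identityʳ _ ⟩
    1# * bit (ρ v) + 0#         ≈⟨ +-identityʳ _ ⟩
    1# * bit (ρ v)              ≈⟨ *-identityˡ _ ⟩
    bit (ρ v)                   ≈⟨ reflexive (≡.cong bit ρv) ⟩
    0#                          ∎

  -- Assignments with at most one pigeon per hole

  -- Storing the content of each hole satisfies all hole clauses by construction; a pigeon may
  -- occupy several holes or none.
  Placement : Set
  Placement = Fin n → Maybe (Fin m)

  inHole : Maybe (Fin m) → Fin m → Bool
  inHole p i = does (Maybe.≡-dec Fin._≟_ p (just i))

  ⟦_⟧ : Placement → Assignment
  ⟦ σ ⟧ (i , j) = inHole (σ j) i

  inHole-functional : ∀ p {i i′} → ¬ (i ≡ i′) → inHole p i ≡ true → inHole p i′ ≡ false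
  inHole-functional p {i} {i′} i≢i′ _ with Maybe.≡-dec Fin._≟_ p (just i) | Maybe.≡-dec Fin._≟_ p (just i′)
  ... | yes ≡.refl | yes ≡.refl = contradiction ≡.refl i≢i′
  ... | yes _      | no _       = ≡.refl

  hole-satisfied : ∀ σ {i i′} → ¬ (i ≡ i′) → ∀ j →
    Sat ⟦ σ ⟧ (negLit (i , j) ∷ negLit (i′ , j) ∷ [])
  hole-satisfied σ {i} {i′} i≢i′ j with inHole (σ j) i in eq
  ... | false = here (eval-negLit ⟦ σ ⟧ (i , j) eq)
  ... | true  = there (here (eval-negLit ⟦ σ ⟧ (i′ , j) (inHole-functional (σ j) i≢i′ eq)))

  pigeon-satisfied : ∀ σ i j → σ j ≡ just i →
    Sat ⟦ σ ⟧ (map (λ j → posLit (i , j)) (allFin n))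
  pigeon-satisfied σ i j σj = Any.map⁺ (lose (∈-allFin j)
    (eval-posLit ⟦ σ ⟧ (i , j) (dec-true (Maybe.≡-dec Fin._≟_ (σ j) (just i)) σj)))

  -- Moving a pigeon along the cube

  Avoids : List LinForm → Placement → Set (c ⊔ ℓ)
  Avoids Ψ σ = All (λ f → ¬ (eval ⟦ σ ⟧ f ≈ 0#)) Ψ

  -- Selected holes lose their former occupant, so every cube point gives a placement. The origin
  -- gives `σ`, and at any other point pigeon `i` has a hole.
  move : Fin m → Placement → Vec Bool n → Placement
  move i σ x j = if lookup x j then just i else σ j

  on-cube : Fin m → Placement → LinForm → Vec Bool n → Carrier
  on-cube i σ f x = eval ⟦ move i σ x ⟧ f

  on-cube-affine : ∀ i σ Ψ → All (IsAffine n) (map (on-cube i σ) Ψ)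
  on-cube-affine i σ []      = []
  on-cube-affine i σ (f ∷ Ψ) =
    eval-affine n (λ x → ⟦ move i σ x ⟧)
      (λ { (i′ , j) → affine-select n (λ p → bit (inHole p i′)) (just i) (σ j) j }) f
    ∷ on-cube-affine i σ Ψ

  Π-nonzero⇒avoids : ∀ i σ Ψ x → ¬ (Π (map (on-cube i σ) Ψ) x ≈ 0#) → Avoids Ψ (move i σ x)
  Π-nonzero⇒avoids i σ []      x ne = []
  Π-nonzero⇒avoids i σ (f ∷ Ψ) x ne =
    (λ f≈0 → ne (trans (*-congʳ f≈0) (zeroˡ _))) ∷
    Π-nonzero⇒avoids i σ Ψ x (λ Π≈0 → ne (trans (*-congˡ Π≈0) (zeroʳ _)))

  avoids⇒Π-nonzero : ∀ i σ Ψ → Avoids Ψ σ →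
    ¬ (Π (map (on-cube i σ) Ψ) (replicate n false) ≈ 0#)
  avoids⇒Π-nonzero i σ []      []        = λ 1≈0 → 0≉1 (sym 1≈0)
  avoids⇒Π-nonzero i σ (f ∷ Ψ) (ne ∷ av) =
    *-nonzero (λ f≈0 → ne (trans (eval-cong origin f) f≈0)) (avoids⇒Π-nonzero i σ Ψ av)
    where
    origin : ∀ v → ⟦ σ ⟧ v ≡ ⟦ move i σ (replicate n false) ⟧ v
    origin (i′ , j) = ≡.cong (λ b → inHole (if b then just i else σ j) i′)
      (≡.sym (Vec.lookup-replicate j false))

  -- Otherwise the product of `Ψ` vanishes off the origin, so its alternating sum equals its nonzero
  -- value at `σ`; yet fewer than `n` affine factors force that sum to be zero.
  placeable : ∀ Ψ σ i → Avoids Ψ σ → length Ψ < n →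
    ¬ (∀ σ′ → Avoids Ψ σ′ → ¬ (∃[ j ] σ′ j ≡ just i))
  placeable Ψ σ i av short absent = ¬¬-cube n off-origin λ vanish →
    avoids⇒Π-nonzero i σ Ψ av
      (trans (sym (alt-supported-at-origin n vanish))
             (alt-Π n _ (on-cube-affine i σ Ψ) short′))
    where
    P : Vec Bool n → Carrier
    P = Π (map (on-cube i σ) Ψ)

    short′ : length (map (on-cube i σ) Ψ) < n
    short′ = ≡.subst (_< n) (≡.sym (List.length-map _ Ψ)) short

    off-origin : ∀ x → ¬ ¬ ((∃[ j ] lookup x j ≡ true) → P x ≈ 0#)
    -- A nonzero product at `x` would make the moved placement avoid `Ψ` with pigeon `i` in hole
    -- `j`, against `absent`.
    off-origin x ¬zero = ¬zero λ { (j , xⱼ) → ⊥-elim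
      (absent (move i σ x)
        (Π-nonzero⇒avoids i σ Ψ x λ P≈0 → ¬zero λ _ → P≈0)
        (j , ≡.cong (if_then just i else σ j) xⱼ)) }

  -- Tree-like derivations

  double : ∀ k r → 2 ^ (k ∸ r) ≤ 2 ^ (k ∸ suc r) ℕ.+ 2 ^ (k ∸ suc r)
  double k r = ℕ.≤-trans
    -- An inequality rather than an equality: subtraction truncates, and for `k ≤ r` the claim reads
    -- 1 ≤ 2.
    (ℕ.^-monoʳ-≤ 2 (ℕ.m≤n+m∸n (k ∸ r) 1))
    (ℕ.≤-reflexive (≡.trans
      (≡.cong (λ e → 2 ^ e ℕ.+ (2 ^ e ℕ.+ 0)) (≡.trans (ℕ.∸-+-assoc k r 1) (≡.cong (k ∸_) (ℕ.+-comm r 1))))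
      (≡.cong (2 ^ (k ∸ suc r) ℕ.+_) (ℕ.+-identityʳ _))))

  module _ (∥_∥ : Carrier → ℕ) (1≤∥_∥ : ∀ a → 1 ≤ ∥ a ∥) (0<n : 0 < n) where
    open Size ∥_∥

    formSize-positive : ∀ f → 1 ≤ formSize f
    formSize-positive f = ℕ.≤-trans (1≤∥ LinForm.const f ∥) (ℕ.m≤n+m _ _)

    clauseSize-positive : ∀ {C f} → f ∈ C → 1 ≤ clauseSize C
    clauseSize-positive {f = f} (here ≡.refl) = ℕ.≤-trans (formSize-positive f) (ℕ.m≤m+n _ _)
    clauseSize-positive         (there f∈C)   = ℕ.≤-trans (clauseSize-positive f∈C) (ℕ.m≤n+m _ _)

    -- Induction on the derivation. The witness `σ` excludes hole clauses and the axiom, since every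
    -- placement satisfies them.
    size-bound : ∀ {C} (π : Deriv NegPHP C) Ψ σ → Avoids Ψ σ →
      (∀ σ′ → Avoids Ψ σ′ → ¬ Sat ⟦ σ′ ⟧ C) → 2 ^ (n ∸ length Ψ) ≤ size π
    size-bound (hyp (pigeon i)) Ψ σ av falsified with length Ψ <? n
    ... | yes short = ⊥-elim (placeable Ψ σ i av short
            λ { σ′ av′ (j , σ′j) → falsified σ′ av′ (pigeon-satisfied σ′ i j σ′j) })
    -- The exponent is zero here, so size at least 1 suffices; the pigeon clause is nonempty because
    -- `0 < n`.
    ... | no long   = ℕ.≤-trans
            (ℕ.≤-reflexive (≡.cong (2 ^_) (ℕ.m≤n⇒m∸n≡0 (ℕ.≮⇒≥ long))))
            (clauseSize-positive (∈-map⁺ (λ j → posLit (i , j)) (∈-allFin (Fin.fromℕ< 0<n))))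
    size-bound (hyp (hole i i′ i≢i′ j)) Ψ σ av falsified =
      ⊥-elim (falsified σ av (hole-satisfied σ i≢i′ j))
    size-bound axiom Ψ σ av falsified =
      ⊥-elim (falsified σ av (here (+-identityˡ 0#)))
    size-bound (weaken π C⊨D) Ψ σ av falsified =
      ℕ.≤-trans (size-bound π Ψ σ av λ σ′ av′ s → falsified σ′ av′ (C⊨D ⟦ σ′ ⟧ s)) (ℕ.m≤n+m _ _)
    size-bound (resolve {E = E} C D f g h α β π₁ π₂ P≋ Q≋ comb E≋) Ψ σ av falsified =
      -- The goal is a decidable inequality of naturals, so excluded middle may be used to ask
      -- whether a placement avoiding the extended list exists.
      decidable-stable (_ ≤? _) λ ¬bound →
      ¬¬-excluded-middle λ where
        -- If `g` vanished at `σ′`, then `f` could not, as `h` would vanish too and satisfy `E`; so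
        -- `σ′` would avoid `f ∷ Ψ`. Hence `g` is nonzero throughout and `Ψ` need not grow.
        (no f-vanishes) → ¬bound (ℕ.≤-trans (size-bound π₂ Ψ σ av λ σ′ av′ s →
          from-D σ′ av′ (λ g≈0 → f-vanishes (σ′ , (λ f≈0 → from-h σ′ av′ f≈0 g≈0) ∷ av′)) s)
          right)
        (yes (σ₁ , av₁)) → ¬¬-excluded-middle λ where
          (no g-vanishes) → ¬bound (ℕ.≤-trans (size-bound π₁ Ψ σ av λ σ′ av′ s →
            from-C σ′ av′ (λ f≈0 → g-vanishes (σ′ , (λ g≈0 → from-h σ′ av′ f≈0 g≈0) ∷ av′)) s)
            left)
          -- Both extensions are realised, and tree-likeness lets the two subtree sizes be added.
          (yes (σ₂ , av₂)) → ¬bound (ℕ.≤-trans (double n (length Ψ)) (ℕ.≤-trans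
            (ℕ.+-mono-≤
              (size-bound π₁ (f ∷ Ψ) σ₁ av₁ λ { σ′ (ne ∷ av′) → from-C σ′ av′ ne })
              (size-bound π₂ (g ∷ Ψ) σ₂ av₂ λ { σ′ (ne ∷ av′) → from-D σ′ av′ ne }))
            both))
      where
      from-C : ∀ σ′ → Avoids Ψ σ′ → ¬ (eval ⟦ σ′ ⟧ f ≈ 0#) → ¬ Sat ⟦ σ′ ⟧ _
      from-C σ′ av′ f≉0 s with Any-resp-⊆ (λ {e} → Equivalence.to (P≋ e)) s
      ... | here f≈0 = f≉0 f≈0
      ... | there s′ = falsified σ′ av′ (Any-resp-⊆ (λ {e} → Equivalence.from (E≋ e)) (there (Any.++⁺ˡ s′)))

      from-D : ∀ σ′ → Avoids Ψ σ′ → ¬ (eval ⟦ σ′ ⟧ g ≈ 0#) → ¬ Sat ⟦ σ′ ⟧ _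
      from-D σ′ av′ g≉0 s with Any-resp-⊆ (λ {e} → Equivalence.to (Q≋ e)) s
      ... | here g≈0 = g≉0 g≈0
      ... | there s′ = falsified σ′ av′ (Any-resp-⊆ (λ {e} → Equivalence.from (E≋ e)) (there (Any.++⁺ʳ C s′)))

      from-h : ∀ σ′ → Avoids Ψ σ′ → eval ⟦ σ′ ⟧ f ≈ 0# → ¬ (eval ⟦ σ′ ⟧ g ≈ 0#)
      from-h σ′ av′ f≈0 g≈0 = falsified σ′ av′ (Any-resp-⊆ (λ {e} → Equivalence.from (E≋ e)) (here (begin
        eval ⟦ σ′ ⟧ h
          ≈⟨ eval-linComb f g h ⟦ σ′ ⟧ comb ⟩
        α * eval ⟦ σ′ ⟧ f + β * eval ⟦ σ′ ⟧ g
          ≈⟨ +-cong (*-congˡ f≈0) (*-congˡ g≈0) ⟩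
        α * 0# + β * 0#
          ≈⟨ +-cong (zeroʳ α) (zeroʳ β) ⟩
        0# + 0#
          ≈⟨ +-identityˡ 0# ⟩
        0# ∎)))

      right : size π₂ ≤ clauseSize E ℕ.+ size π₁ ℕ.+ size π₂
      right = ℕ.m≤n+m _ _

      left : size π₁ ≤ clauseSize E ℕ.+ size π₁ ℕ.+ size π₂
      left = ℕ.≤-trans (ℕ.m≤n+m _ (clauseSize E)) (ℕ.m≤m+n _ _)

      both : size π₁ ℕ.+ size π₂ ≤ clauseSize E ℕ.+ size π₁ ℕ.+ size π₂
      both = ℕ.+-monoˡ-≤ (size π₂) (ℕ.m≤n+m _ (clauseSize E))

    refutation-size : (π : Refutation NegPHP) → 2 ^ n ≤ size π
    -- At the root no form is imposed, and the placement with all holes empty is the witness.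
    refutation-size π = size-bound π [] (λ _ → nothing) [] λ _ _ ()

mainTheorem5 : ∀ {c ℓ : Level} →
    Σ ℕ λ k → Σ ℕ λ N →
    (F : Field c ℓ) (∥_∥ : Field.Carrier F → ℕ) → (∀ a → 1 ≤ ∥ a ∥) →
    (m n : ℕ) → N ≤ n → n < m →
    (π : LinearClauses.Refutation F m n (LinearClauses.NegPHP F m n)) →
    2 ^ ((n ∸ 1) / 2) ≤ LinearClauses.Size.size F m n ∥_∥ π ^ k
-- Exponent 1 suffices since `2 ^ n` already dominates the target; the threshold 1 supplies `0 < n`.
mainTheorem5 = 1 , 1 , λ F ∥_∥ 1≤∥_∥ m n 0<n n<m π →
  ℕ.≤-trans
    (ℕ.^-monoʳ-≤ 2 (ℕ.≤-trans (ℕ.m/n≤m (n ∸ 1) 2) (ℕ.m∸n≤m n 1)))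
    (ℕ.≤-trans (PHP.refutation-size F m n ∥_∥ 1≤∥_∥ 0<n π)
               (ℕ.≤-reflexive (≡.sym (ℕ.*-identityʳ _))))
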